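{- Let $k$ be a positive integer. An independence system $\mathcal{F}=(S,\mathcal{I})$ is $k$-circuit bounded if and only if, for any $k+1$ distinct circuits $C_1,\dots,C_{k+1}$ of $\mathcal{F}$ such that $e\in\bigcap_{i=1}^{k+1}C_i$ for some $e\in S$, the set $\big(\bigcup_{i=1}^{k+1}C_i\big)\setminus\{e\}$ contains a circuit.
   Context: An independence system $(S,\mathcal{I})$ is a finite set $S$ with a nonempty downward-closed family $\mathcal{I}\subseteq2^S$ of independent sets. Circuits are the inclusion-wise minimal non-independent sets. $k$-circuit bounded: for every $I\in\mathcal{I}$ and every $e\in S\setminus I$, the set $I\cup\{e\}$ contains at most $k$ distinct circuits. -}

module Defs where

open import Data.Fin.Base using (Fin)
open import Data.Fin.Subset using (Subset; _∈_; _∉_; _⊆_; _∪_; _-_; ⁅_⁆; ⋃; ⋂)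
open import Data.List.Base using (length; tabulate)
import Data.List.Membership.Propositional as List
open import Data.List.Relation.Unary.Unique.Propositional using (Unique)
open import Data.Nat.Base using (ℕ; suc; _≤_)
open import Data.Product.Base using (_×_; ∃-syntax)
open import Function.Bundles using (_⇔_)
open import Function.Definitions using (Injective)
open import Level using (Level; _⊔_) renaming (suc to lsuc)
open import Relation.Binary.PropositionalEquality.Core using (_≡_)
open import Relation.Nullary.Negation.Core using (¬_)
open import Relation.Unary using (Pred; Decidable; Satisfiable)

-- The ground set is Fin n.  Decidability of independence makes the family
-- an honest element of the power set of the (finite) power set of Fin n.
record IndependenceSystem (n : ℕ) (ℓ : Level) : Set (lsuc ℓ) where
  field
    Independent  : Pred (Subset n) ℓ
    independent? : Decidable Independent
    nonempty     : Satisfiable Independent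
    downClosed   : ∀ {A B} → A ⊆ B → Independent B → Independent A

  Circuit : Pred (Subset n) ℓ
  Circuit C = ¬ Independent C × (∀ {D} → ¬ Independent D → D ⊆ C → D ≡ C)

-- P holds of at most k elements: its extension is listed without repetition
-- by a list of length at most k.
AtMost : ∀ {a p} {A : Set a} → ℕ → Pred A p → Set (a ⊔ p)
AtMost {A = A} k P =
  ∃[ xs ] Unique xs × (∀ (x : A) → x List.∈ xs ⇔ P x) × length xs ≤ k

module _ {n : ℕ} {ℓ : Level} (F : IndependenceSystem n ℓ) where
  open IndependenceSystem F

  CircuitBounded : ℕ → Set ℓ
  CircuitBounded k =
    ∀ (I : Subset n) → Independent I → ∀ (e : Fin n) → e ∉ I →
    AtMost k (λ C → Circuit C × C ⊆ I ∪ ⁅ e ⁆)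

  CircuitElimination : ℕ → Set ℓ
  CircuitElimination k =
    ∀ (C : Fin (suc k) → Subset n) → Injective _≡_ _≡_ C →
    (∀ i → Circuit (C i)) →
    ∀ (e : Fin n) → e ∈ ⋂ (tabulate C) →
    ∃[ D ] Circuit D × D ⊆ ⋃ (tabulate C) - e

{-# OPTIONS --safe #-}

-- Let e lie in every circuit C₀, …, C_k and let U be their union.  If U - e were
-- independent, all the Cᵢ would be circuits of (U - e) ∪ {e}, too many for
-- k-circuit boundedness; so U - e is dependent and contains a circuit.
-- Conversely, a circuit inside I ∪ {e} with I independent must contain e, so
-- k + 1 of them would, by elimination, yield a circuit inside I.
module Submission where

open import Defs
open import Data.Nat.Base using (ℕ; NonZero)
open import Function.Bundles using (_⇔_)
open import Level using (Level)

open import Data.Empty using (⊥-elim)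
open import Data.Fin.Base using (Fin; zero; suc; inject≤)
open import Data.Fin.Properties using (injective⇒≤; inject≤-injective; _≟_)
open import Data.Fin.Subset
  using (Side; Subset; inside; outside; _∈_; _∉_; _⊆_; _⊂_; _⊄_; _∪_; _-_; ⁅_⁆; ⋃; ⋂)
open import Data.Fin.Subset.Induction using (⊂-wellFounded; Acc; acc)
open import Data.Fin.Subset.Properties
  using (_∈?_; _⊆?_; _⊂?_; anySubset?; ⊆-antisym; ⊆-refl; ⊂-irref; p─q─q≡p─q; p─q⊆p
        ; x∈p⇒p-x⊂p; x∈p∧x≢y⇒x∈p-y; x∈p∪q⁺; x∈p∪q⁻; x∈p∩q⁺; x∈⁅x⁆; x∈⁅y⁆⇒x≡y
        ; ∈⊤; ∉⊥)
open import Data.List.Base using (List; []; _∷_; lookup; tabulate; filter; cartesianProductWith)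
import Data.List.Membership.Propositional as List
open import Data.List.Membership.Propositional.Properties
  using (∈-cartesianProductWith⁺; ∈-filter⁺; ∈-filter⁻; ∈-lookup)
import Data.List.Membership.Setoid.Properties as SetoidMembership
open import Data.List.Properties using (foldr-preservesᵇ; foldr-preservesᵒ)
import Data.List.Relation.Unary.All as All
import Data.List.Relation.Unary.All.Properties as All
open import Data.List.Relation.Unary.AllPairs using ([]; _∷_)
open import Data.List.Relation.Unary.Any using (here; there; index)
import Data.List.Relation.Unary.Any.Properties as Any
open import Data.List.Relation.Unary.Unique.Propositional using (Unique)
import Data.List.Relation.Unary.Unique.Propositional.Properties as Unique
open import Data.Nat.Base using (suc; _≤_)
open import Data.Nat.Properties using (≤-trans; 1+n≰n; ≮⇒≥)
open import Data.Product.Base using (_×_; _,_; proj₁; proj₂; ∃-syntax)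
open import Data.Sum.Base using (inj₁; inj₂; [_,_])
open import Data.Vec.Base using ([]; _∷_)
open import Data.Vec.Properties using (∷-injective)
open import Function.Base using (_∘_)
open import Function.Bundles using (mk⇔; Equivalence)
open import Function.Definitions using (Injective)
open import Relation.Binary.PropositionalEquality using (_≡_; refl; sym; cong; setoid)
open import Relation.Nullary.Decidable using (yes; no; ¬?; _×-dec_; map′; decidable-stable)
open import Relation.Nullary.Negation using (¬_; contradiction)
open import Relation.Unary using (Pred; Decidable)

private
  variable
    a p : Level
    A : Set a
    m n k : ℕ

lookup-injective : ∀ {xs : List A} → Unique xs → Injective _≡_ _≡_ (lookup xs)
lookup-injective (_  ∷ _)  {zero}  {zero}  _  = refl
lookup-injective (px ∷ _)  {zero}  {suc j} eq = ⊥-elim (All.lookup px (∈-lookup j) eq)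
lookup-injective (px ∷ _)  {suc i} {zero}  eq = ⊥-elim (All.lookup px (∈-lookup i) (sym eq))
lookup-injective (_  ∷ u)  {suc i} {suc j} eq = cong suc (lookup-injective u eq)

-- Pigeonhole: sending `i` to the position of `f i` in the list is injective, because equal
-- positions hold equal entries and `f` is injective. So `m` is at most the length of the list.
AtMost⇒≤ : {P : Pred A p} → AtMost k P →
           (f : Fin m → A) → Injective _≡_ _≡_ f → (∀ i → P (f i)) → m ≤ k
AtMost⇒≤ {A = A} (xs , _ , xs⇔P , len≤k) f f-inj Pf =
  ≤-trans (injective⇒≤ index-inj) len≤k
  where
  f∈xs : ∀ i → f i List.∈ xs
  f∈xs i = Equivalence.from (xs⇔P (f i)) (Pf i)
  index-inj : Injective _≡_ _≡_ (index ∘ f∈xs)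
  index-inj {i} {j} = f-inj ∘ SetoidMembership.index-injective (setoid A) (f∈xs i) (f∈xs j)

sides : List Side
sides = outside ∷ inside ∷ []

-- `AtMost` asks for an explicit list, so the power set is enumerated once; the circuits in question
-- are then filtered out of it.
subsets : ∀ n → List (Subset n)
subsets 0       = [] ∷ []
subsets (suc n) = cartesianProductWith _∷_ sides (subsets n)

∈-subsets : (X : Subset n) → X List.∈ subsets n
∈-subsets []            = here refl
∈-subsets (outside ∷ X) = ∈-cartesianProductWith⁺ _∷_ {xs = sides} (here refl) (∈-subsets X)
∈-subsets (inside  ∷ X) = ∈-cartesianProductWith⁺ _∷_ {xs = sides} (there (here refl)) (∈-subsets X)

subsets-unique : ∀ n → Unique (subsets n)
subsets-unique 0       = All.[] ∷ []
subsets-unique (suc n) = Unique.cartesianProductWith⁺ _∷_ ∷-injective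
  (((λ ()) All.∷ All.[]) ∷ (All.[] ∷ [])) (subsets-unique n)

-- A converse to the pigeonhole bound: if the repetition-free list of all subsets satisfying `P` had
-- more than `k` entries, it would supply a forbidden injective family.
AtMost-subsets : {P : Pred (Subset n) p} → Decidable P →
                 (∀ (f : Fin (suc k) → Subset n) → Injective _≡_ _≡_ f → ¬ (∀ i → P (f i))) →
                 AtMost k P
AtMost-subsets {n = n} {k = k} {P = P} P? ¬inj =
  xs , xs-unique , (λ X → mk⇔ (proj₂ ∘ ∈-filter⁻ P? {xs = subsets n}) (∈-filter⁺ P? (∈-subsets X))) ,
  -- Since `k<len` says `suc k ≤ length xs`, `inject≤` selects the first `k + 1` positions.
  ≮⇒≥ λ k<len → ¬inj (λ i → lookup xs (inject≤ i k<len))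
    (inject≤-injective k<len k<len _ _ ∘ lookup-injective xs-unique)
    (λ i → proj₂ (∈-filter⁻ P? {xs = subsets n} (∈-lookup (inject≤ i k<len))))
  where
  xs : List (Subset n)
  xs = filter P? (subsets n)
  xs-unique : Unique xs
  xs-unique = Unique.filter⁺ P? (subsets-unique n)

⊆∧⊄⇒≡ : {X Y : Subset n} → X ⊆ Y → X ⊄ Y → X ≡ Y
⊆∧⊄⇒≡ {X = X} X⊆Y X⊄Y = ⊆-antisym X⊆Y λ {x} x∈Y →
  decidable-stable (x ∈? X) λ x∉X → X⊄Y (X⊆Y , x , x∈Y , x∉X)

-- Removing `x` a second time changes nothing, yet it would shrink `X - x` strictly if `x` were
-- still in it.
x∉p-x : (X : Subset n) (x : Fin n) → x ∉ X - x
x∉p-x X x x∈ = ⊂-irref (p─q─q≡p─q X ⁅ x ⁆) (x∈p⇒p-x⊂p x∈)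

X⊆X-x∪⁅x⁆ : (X : Subset n) (x : Fin n) → X ⊆ (X - x) ∪ ⁅ x ⁆
X⊆X-x∪⁅x⁆ X x {y} y∈X with y ≟ x
... | yes refl = x∈p∪q⁺ (inj₂ (x∈⁅x⁆ x))
... | no  y≢x  = x∈p∪q⁺ (inj₁ (x∈p∧x≢y⇒x∈p-y y∈X y≢x))

X⊆Y∪⁅x⁆∧x∉X⇒X⊆Y : {X Y : Subset n} {x : Fin n} → X ⊆ Y ∪ ⁅ x ⁆ → x ∉ X → X ⊆ Y
X⊆Y∪⁅x⁆∧x∉X⇒X⊆Y {Y = Y} {x} X⊆ x∉X y∈X with x∈p∪q⁻ Y ⁅ x ⁆ (X⊆ y∈X)
... | inj₁ y∈Y = y∈Y
... | inj₂ y∈x with refl ← x∈⁅y⁆⇒x≡y x y∈x = contradiction y∈X x∉X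

⊆⋃-tabulate : (C : Fin m → Subset n) → ∀ i → C i ⊆ ⋃ (tabulate C)
⊆⋃-tabulate C i {x} x∈Ci =
  foldr-preservesᵒ {P = x ∈_} (λ _ _ → x∈p∪q⁺) _ (tabulate C) (inj₂ (Any.tabulate⁺ i x∈Ci))

⋃-tabulate⊆ : (C : Fin m → Subset n) {X : Subset n} → (∀ i → C i ⊆ X) → ⋃ (tabulate C) ⊆ X
⋃-tabulate⊆ C {X} C⊆X = foldr-preservesᵇ {P = _⊆ X}
  (λ Y⊆X Z⊆X x∈Y∪Z → [ Y⊆X , Z⊆X ] (x∈p∪q⁻ _ _ x∈Y∪Z))
  (λ x∈⊥ → contradiction x∈⊥ ∉⊥) (All.tabulate⁺ {f = C} C⊆X)

∈⋂-tabulate⁺ : (C : Fin m → Subset n) {x : Fin n} → (∀ i → x ∈ C i) → x ∈ ⋂ (tabulate C)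
∈⋂-tabulate⁺ C {x} x∈C = foldr-preservesᵇ {P = x ∈_}
  (λ x∈Y x∈Z → x∈p∩q⁺ (x∈Y , x∈Z)) ∈⊤ (All.tabulate⁺ {f = C} x∈C)

module _ {n : ℕ} {ℓ : Level} (F : IndependenceSystem n ℓ) where
  open IndependenceSystem F

  -- Minimality is restated as the absence of a dependent proper subset, which a search through the
  -- finitely many subsets decides.
  circuit? : Decidable Circuit
  circuit? C = map′
    (λ (dep , min) → dep , λ {D} depD D⊆C → ⊆∧⊄⇒≡ D⊆C λ D⊂C → min (D , depD , D⊂C))
    (λ (dep , min) → dep , λ (D , depD , D⊂C@(D⊆C , _)) → ⊂-irref (min depD D⊆C) D⊂C)
    (¬? (independent? C) ×-dec ¬? (anySubset? λ D → ¬? (independent? D) ×-dec (D ⊂? C)))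

  -- Descent along strict inclusion: pass to a dependent proper subset as long as the search finds
  -- one. The descent is well-founded, and a set where the search fails is minimal dependent.
  dependent⇒circuit : ∀ {X} → ¬ Independent X → ∃[ C ] Circuit C × C ⊆ X
  dependent⇒circuit {X} = go X (⊂-wellFounded X)
    where
    go : ∀ X → Acc _⊂_ X → ¬ Independent X → ∃[ C ] Circuit C × C ⊆ X
    go X (acc rec) dep with anySubset? (λ D → ¬? (independent? D) ×-dec (D ⊂? X))
    ... | yes (D , depD , D⊂X@(D⊆X , _)) =
      let C , circ , C⊆D = go D (rec D⊂X) depD in C , circ , D⊆X ∘ C⊆D
    ... | no  min =
      X , (dep , λ {D} depD D⊆X → ⊆∧⊄⇒≡ D⊆X λ D⊂X → min (D , depD , D⊂X)) , ⊆-refl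

  circuit⊈independent : ∀ {C I} → Circuit C → Independent I → ¬ C ⊆ I
  circuit⊈independent (dep , _) ind C⊆I = dep (downClosed C⊆I ind)

  bounded⇒elimination : CircuitBounded F k → CircuitElimination F k
  bounded⇒elimination bounded C C-inj circ e _ = dependent⇒circuit λ ind →
    -- Boundedness is applied to `I = U - e`, so that `k + 1` circuits would number at most `k`.
    1+n≰n (AtMost⇒≤ (bounded (U - e) ind e (x∉p-x U e)) C C-inj λ i →
      circ i , λ x∈Ci → X⊆X-x∪⁅x⁆ U e (⊆⋃-tabulate C i x∈Ci))
    where
    U : Subset n
    U = ⋃ (tabulate C)

  elimination⇒bounded : CircuitElimination F k → CircuitBounded F k
  elimination⇒bounded elim I ind e _ =
    AtMost-subsets (λ C → circuit? C ×-dec (C ⊆? I ∪ ⁅ e ⁆)) λ C C-inj C-circ →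
      let e∈C : ∀ i → e ∈ C i
          e∈C i = decidable-stable (e ∈? C i) λ e∉Ci →
            circuit⊈independent (proj₁ (C-circ i)) ind
              (X⊆Y∪⁅x⁆∧x∉X⇒X⊆Y (proj₂ (C-circ i)) e∉Ci)
          D , D-circ , D⊆U-e = elim C C-inj (proj₁ ∘ C-circ) e (∈⋂-tabulate⁺ C e∈C)
          -- Every `C i` lies in `I ∪ ⁅ e ⁆`, hence so do their union and `D`. As `D` also avoids
          -- `e`, it lies in `I`.
          D⊆I∪e : D ⊆ I ∪ ⁅ e ⁆
          D⊆I∪e = ⋃-tabulate⊆ C (proj₂ ∘ C-circ) ∘ p─q⊆p (⋃ (tabulate C)) ⁅ e ⁆ ∘ D⊆U-e
      in circuit⊈independent D-circ ind
           (X⊆Y∪⁅x⁆∧x∉X⇒X⊆Y D⊆I∪e (x∉p-x (⋃ (tabulate C)) e ∘ D⊆U-e))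

theorem16 : ∀ {ℓ : Level} {n : ℕ} (k : ℕ) .{{_ : NonZero k}} (F : IndependenceSystem n ℓ) →
    CircuitBounded F k ⇔ CircuitElimination F k
theorem16 k F = mk⇔ (bounded⇒elimination F) (elimination⇒bounded F)
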